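{- The set $\mathcal{F}_{C_3+P_1}$ has infinitely many non-isomorphic graphs.
   Context: Graphs are finite, without loops or multiple edges. For a vertex $u$ of a graph $G$, the local complementation $G*u$ is obtained from $G$ by complementing the adjacency between every pair of distinct neighbours of $u$. For an edge $uv$ of $G$, the edge pivot is $G\wedge uv=((G*u)*v)*u$. A graph $G$ contains $H$ as a pivot-minor if $H$ can be obtained from $G$ by a sequence of vertex deletions and edge pivots. For a graph $H$, $\mathcal{F}_H$ is the set of induced-subgraph-minimal graphs containing a pivot-minor isomorphic to $H$: a graph $F$ is in $\mathcal{F}_H$ if and only if $F$ contains a pivot-minor isomorphic to $H$ but no proper induced subgraph of $F$ does. $C_3+P_1$ is the disjoint union of a triangle and an isolated vertex. -}

module Defs where

open import Data.Bool using (Bool; true; false; not; _∧_; _xor_)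
open import Data.Bool.Properties using (∧-comm; ∧-zeroʳ)
open import Data.Fin using (Fin; punchIn; splitAt; _≟_)
open import Data.Fin.Properties using (punchIn-injective)
open import Data.Nat using (ℕ; suc; _+_; _<_)
open import Data.Product using (∃; ∃-syntax; Σ-syntax; _×_; proj₂)
open import Data.Sum using (_⊎_; inj₁; inj₂)
open import Function.Bundles using (_↔_; _↣_; mk↣; Inverse; Injection)
open import Relation.Binary.PropositionalEquality
  using (_≡_; _≢_; refl; sym; trans; cong; cong₂)
open import Relation.Nullary using (¬_; yes; no; contradiction)
open import Relation.Nullary.Decidable using (⌊_⌋)

record Graph (n : ℕ) : Set where
  field
    adj    : Fin n → Fin n → Bool
    symm   : ∀ u v → adj u v ≡ adj v u
    irrefl : ∀ v → adj v v ≡ false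

open Graph public

distinct : ∀ {n} → Fin n → Fin n → Bool
distinct u v = not ⌊ u ≟ v ⌋

distinct-symm : ∀ {n} (u v : Fin n) → distinct u v ≡ distinct v u
distinct-symm u v with u ≟ v | v ≟ u
... | yes _ | yes _ = refl
... | no  _ | no  _ = refl
... | yes p | no  q = contradiction (sym p) q
... | no  p | yes q = contradiction (sym q) p

distinct-irrefl : ∀ {n} (v : Fin n) → distinct v v ≡ false
distinct-irrefl v with v ≟ v
... | yes _ = refl
... | no  p = contradiction refl p

infix 4 _≅_

record _≅_ {m n} (G : Graph m) (H : Graph n) : Set where
  field
    bijection : Fin m ↔ Fin n
    preserves : ∀ u v → adj H (Inverse.to bijection u) (Inverse.to bijection v) ≡ adj G u v

infixl 8 _[_] _-_ _*_

-- Up to isomorphism, the induced subgraphs of G are the G [ f ] with f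
-- injective (the subgraph induced by the image of f), and G [ f ] is a
-- proper one exactly when it has fewer vertices than G.
_[_] : ∀ {m n} → Graph n → Fin m ↣ Fin n → Graph m
G [ f ] = record
  { adj    = λ u v → adj G (to u) (to v)
  ; symm   = λ u v → symm G (to u) (to v)
  ; irrefl = λ v → irrefl G (to v)
  } where open Injection f using (to)

_-_ : ∀ {n} → Graph (suc n) → Fin (suc n) → Graph n
G - v = G [ mk↣ {to = punchIn v} (punchIn-injective v _ _) ]

_*_ : ∀ {n} → Graph n → Fin n → Graph n
G * u = record
  { adj    = λ v w → adj G v w xor ((adj G u v ∧ adj G u w) ∧ distinct v w)
  ; symm   = λ v w → cong₂ _xor_ (symm G v w)
                       (cong₂ _∧_ (∧-comm (adj G u v) (adj G u w)) (distinct-symm v w))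
  ; irrefl = λ v → cong₂ _xor_ (irrefl G v)
                     (trans (cong ((adj G u v ∧ adj G u v) ∧_) (distinct-irrefl v))
                            (∧-zeroʳ _))
  }

pivot : ∀ {n} → Graph n → Fin n → Fin n → Graph n
pivot G u v = ((G * u) * v) * u

-- G ⟶* K : the labelled graph K results from G by a sequence of vertex
-- deletions and edge pivots.
infix 4 _⟶*_

data _⟶*_ : ∀ {m n} → Graph m → Graph n → Set where
  done     : ∀ {n} {G : Graph n} → G ⟶* G
  delete   : ∀ {m n} {G : Graph (suc m)} {K : Graph n} v →
             G - v ⟶* K → G ⟶* K
  pivot-at : ∀ {m n} {G : Graph m} {K : Graph n} u v → adj G u v ≡ true →
             pivot G u v ⟶* K → G ⟶* K

HasPivotMinor : ∀ {m n} → Graph m → Graph n → Set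
HasPivotMinor G H = ∃[ k ] ∃[ K ] (G ⟶* K) × (_≅_ {k} K H)

𝓕 : ∀ {m} → Graph m → ∀ {n} → Graph n → Set
𝓕 H {n} F =
  HasPivotMinor F H ×
  (∀ {k} → k < n → (f : Fin k ↣ Fin n) → ¬ HasPivotMinor (F [ f ]) H)

complete : ∀ n → Graph n
complete n = record { adj = distinct ; symm = distinct-symm ; irrefl = distinct-irrefl }

-- Disjoint union: the first m vertices carry G, the last n carry H.
infixl 6 _⊕_

_⊕_ : ∀ {m n} → Graph m → Graph n → Graph (m + n)
_⊕_ {m} {n} G H = record
  { adj    = λ u v → adj⊎ (splitAt m u) (splitAt m v)
  ; symm   = λ u v → symm⊎ (splitAt m u) (splitAt m v)
  ; irrefl = λ v → irrefl⊎ (splitAt m v)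
  } where
  adj⊎ : Fin m ⊎ Fin n → Fin m ⊎ Fin n → Bool
  adj⊎ (inj₁ u) (inj₁ v) = adj G u v
  adj⊎ (inj₂ u) (inj₂ v) = adj H u v
  adj⊎ _        _        = false

  symm⊎ : ∀ x y → adj⊎ x y ≡ adj⊎ y x
  symm⊎ (inj₁ u) (inj₁ v) = symm G u v
  symm⊎ (inj₁ u) (inj₂ v) = refl
  symm⊎ (inj₂ u) (inj₁ v) = refl
  symm⊎ (inj₂ u) (inj₂ v) = symm H u v

  irrefl⊎ : ∀ x → adj⊎ x x ≡ false
  irrefl⊎ (inj₁ v) = irrefl G v
  irrefl⊎ (inj₂ v) = irrefl H v

C₃ : Graph 3
C₃ = complete 3

P₁ : Graph 1
P₁ = complete 1

C₃+P₁ : Graph 4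
C₃+P₁ = C₃ ⊕ P₁

-- P holds on pairwise non-isomorphic graphs indexed by ℕ.
InfinitelyMany : (∀ {n} → Graph n → Set) → Set
InfinitelyMany P =
  Σ[ F ∈ (ℕ → ∃ Graph) ]
    (∀ i → P (proj₂ (F i))) ×
    (∀ i j → i ≢ j → ¬ (proj₂ (F i) ≅ proj₂ (F j)))

{-# OPTIONS --safe #-}
module Submission where

-- The family consists of P₁ + C_N for odd N ≥ 3. Pivoting on an edge of C_N and
-- deleting its ends leaves C_{N-2}, so each of these graphs contains C₃ + P₁.
--
-- For minimality, let A be the adjacency matrix of G over 𝔽₂. If H arises from
-- G by edge pivots, then exchanging x and y at a certain set T of vertices maps
-- the graph space {(x , A x)} of H onto that of G. Let C₃ + P₁ be induced in such
-- an H with G = P₁ + C_N. If it avoids a cycle vertex v ∉ T, then C_N - v being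
-- bipartite makes H - v bipartite, which excludes the triangle. If only the
-- isolated vertex of G was deleted, then every avoided cycle vertex is in T and
-- the row of the isolated vertex of C₃ + P₁ gives some (x , y) with y = A x on C_N,
-- where either y is a unit vector, which is impossible since the columns of C_N
-- have even sum, or y = 0, which is impossible since the kernel of C_N is spanned
-- by the all-ones vector while x vanishes somewhere.

open import Defs

open import Algebra.Bundles using (CommutativeRing)
open import Data.Bool using (Bool; true; false; not; _∧_; _xor_; if_then_else_)
import Data.Bool as Bool
open import Data.Bool.Properties
  using (∧-comm; ∧-identityʳ; ∧-zeroʳ; ∧-distribʳ-xor; ∧-distribˡ-xor; not-involutive;
         xor-comm; xor-same; xor-identityʳ; not-distribˡ-xor;
         xor-∧-commutativeRing)
open import Data.Bool.Solver using (module xor-∧-Solver)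
open import Data.Fin using (Fin; zero; suc; fromℕ; inject₁; punchIn; _≟_)
open import Data.Fin.Patterns using (0F; 1F; 2F; 3F)
open import Data.Fin.Permutation using (↔⇒≡)
open import Data.Fin.Properties
  using (any?; all?; injective⇒≤; ¬∀⟶∃¬; punchIn-injective; punchInᵢ≢i; suc-injective)
open import Data.Fin.Relation.Unary.Top using (view; ‵fromℕ; ‵inject₁; view-fromℕ; view-inject₁)
open import Data.Nat using (ℕ; zero; suc; _+_; _<_) renaming (_*_ to _·_)
import Data.Nat.Properties as ℕ
open import Data.Product using (∃-syntax; _,_; proj₁; proj₂)
open import Data.Sum using ([_,_]′)
open import Function using (_∘_; id)
open import Function.Bundles using (_↣_; mk↔ₛ′; Inverse; Injection)
open import Function.Definitions using (Injective)
open import Function.Properties.Inverse using (↔-sym; ↔⇒↣)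
open import Relation.Binary.PropositionalEquality
  using (_≡_; _≢_; _≗_; refl; sym; trans; cong; cong₂; module ≡-Reasoning)
open import Relation.Nullary using (¬_; yes; no; contradiction; does)
open import Relation.Nullary.Decidable using (dec-true; dec-false; toSum; toWitness)

open import Algebra.Properties.Semiring.Sum (CommutativeRing.semiring xor-∧-commutativeRing)
  using (sum; sum-cong-≗; sum-replicate-zero; ∑-distrib-+; ∑-comm; ∑-permute; *-distribˡ-sum)

open xor-∧-Solver using (solve; _:+_; _:*_; _:=_; con)

private
  variable
    k m n : ℕ

-- Booleans as the field 𝔽₂, and the Kronecker delta

xor≡false : ∀ x y → x xor y ≡ false → x ≡ y
xor≡false true  true  _ = refl
xor≡false false y     e = sym e

δ : Fin n → Fin n → Bool
δ i j = does (i ≟ j)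

δ-refl : (i : Fin n) → δ i i ≡ true
δ-refl i = dec-true (i ≟ i) refl

δ-≢ : {i j : Fin n} → i ≢ j → δ i j ≡ false
δ-≢ {i = i} {j} = dec-false (i ≟ j)

δ⇒≡ : (i j : Fin n) → δ i j ≡ true → i ≡ j
δ⇒≡ i j e with i ≟ j
... | yes i≡j = i≡j
... | no  _   = contradiction e λ ()

sum-δ : (i : Fin n) (x : Fin n → Bool) → sum (λ j → δ i j ∧ x j) ≡ x i
sum-δ {suc n} zero x = trans (cong (x zero xor_) (sum-replicate-zero n)) (xor-identityʳ _)
sum-δ (suc i) x = sum-δ i (x ∘ suc)

distinct-≢ : {u v : Fin n} → u ≢ v → distinct u v ≡ true
distinct-≢ {u = u} {v} u≢v with u ≟ v
... | yes u≡v = contradiction u≡v u≢v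
... | no  _   = refl

distinct-injective : {ι : Fin m → Fin n} → Injective _≡_ _≡_ ι →
                     ∀ x y → distinct (ι x) (ι y) ≡ distinct x y
distinct-injective ι-inj x y with x ≟ y
... | yes refl = distinct-irrefl _
... | no  x≢y  = distinct-≢ (x≢y ∘ ι-inj)

-- Induced subgraphs

Induces : (Fin m → Fin n) → Graph m → Graph n → Set
Induces ι K G = ∀ x y → adj K x y ≡ adj G (ι x) (ι y)

module _ {ι : Fin m → Fin n} (ι-inj : Injective _≡_ _≡_ ι) where

  *-induces : {K : Graph m} {G : Graph n} → Induces ι K G →
              ∀ u → Induces ι (K * u) (G * ι u)
  *-induces K≈G u x y = cong₂ _xor_ (K≈G x y)
    (cong₂ _∧_ (cong₂ _∧_ (K≈G u x) (K≈G u y)) (sym (distinct-injective ι-inj x y)))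

  pivot-induces : {K : Graph m} {G : Graph n} → Induces ι K G →
                  ∀ u v → Induces ι (pivot K u v) (pivot G (ι u) (ι v))
  pivot-induces {K} {G} K≈G u v =
    *-induces {(K * u) * v} {(G * ι u) * ι v}
      (*-induces {K * u} {G * ι u} (*-induces {K} {G} K≈G u) v) u

-- Graphs with pointwise equal adjacency need not be equal as records, so the sequence of operations
-- is replayed step by step.
HasPivotMinor-resp-≈ : {G G′ : Graph n} {H : Graph m} → Induces id G G′ →
                       HasPivotMinor G′ H → HasPivotMinor G H
HasPivotMinor-resp-≈ {G = G} G≈G′ (_ , _ , done , K≅H) =
  _ , G , done , record
    { bijection = bijection
    ; preserves = λ u v → trans (preserves u v) (sym (G≈G′ u v)) }
  where open _≅_ K≅H
HasPivotMinor-resp-≈ {G = G} {G′} {H} G≈G′ (k , K , delete v s , K≅H)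
  with k′ , K′ , s′ , K′≅H ← HasPivotMinor-resp-≈ {G = G - v} {G′ - v} {H}
         (λ x y → G≈G′ (punchIn v x) (punchIn v y)) (k , K , s , K≅H)
  = k′ , K′ , delete v s′ , K′≅H
HasPivotMinor-resp-≈ {G = G} {G′} {H} G≈G′ (k , K , pivot-at u v uv s , K≅H)
  with k′ , K′ , s′ , K′≅H ← HasPivotMinor-resp-≈ {G = pivot G u v} {pivot G′ u v} {H}
         (pivot-induces id {G} {G′} G≈G′ u v) (k , K , s , K≅H)
  = k′ , K′ , pivot-at u v (trans (G≈G′ u v) uv) s′ , K′≅H

-- Adjacency after an edge pivot

-- The principal pivot transform of the adjacency matrix on {a, b}, entry by entry: the block on {a,
-- b} is its own inverse, the other entries of rows a and b trade places, and `other` is the Schur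
-- complement.
record IsPivot (G : Graph n) (a b : Fin n) (G′ : Graph n) : Set where
  field
    edge   : adj G a b ≡ true
    edge′  : adj G′ a b ≡ true
    swaps  : ∀ {w} → w ≢ a → w ≢ b → adj G′ a w ≡ adj G b w
    swaps′ : ∀ {w} → w ≢ a → w ≢ b → adj G′ b w ≡ adj G a w
    other  : ∀ {w x} → w ≢ a → w ≢ b → x ≢ a → x ≢ b →
      adj G′ w x ≡ adj G w x xor ((adj G a w ∧ adj G b x) xor (adj G a x ∧ adj G b w))

module _ (G : Graph n) {a b : Fin n} (ab : adj G a b ≡ true) where

  adjacent⇒≢ : a ≢ b
  adjacent⇒≢ refl = contradiction (trans (sym ab) (irrefl G a)) λ ()

  pivot-swaps : ∀ {w} → w ≢ a → w ≢ b → adj (pivot G a b) a w ≡ adj G b w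
  pivot-swaps {w} w≢a w≢b
    rewrite distinct-≢ (w≢a ∘ sym) | distinct-≢ (w≢b ∘ sym)
          | distinct-≢ (adjacent⇒≢ ∘ sym)
          | distinct-irrefl a | irrefl G a | symm G b a | ab
    with adj G a w | adj G b w
  ... | true  | true  = refl
  ... | true  | false = refl
  ... | false | true  = refl
  ... | false | false = refl

  pivot-swaps′ : ∀ {w} → w ≢ a → w ≢ b → adj (pivot G a b) b w ≡ adj G a w
  pivot-swaps′ {w} w≢a w≢b
    rewrite distinct-≢ (w≢a ∘ sym) | distinct-≢ (w≢b ∘ sym) | distinct-≢ adjacent⇒≢
          | distinct-≢ (adjacent⇒≢ ∘ sym)
          | distinct-irrefl b | irrefl G a | irrefl G b | symm G b a | ab
    with adj G a w | adj G b w
  ... | true  | true  = refl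
  ... | true  | false = refl
  ... | false | true  = refl
  ... | false | false = refl

  pivot-edge : adj (pivot G a b) a b ≡ true
  pivot-edge
    rewrite distinct-≢ adjacent⇒≢ | distinct-≢ (adjacent⇒≢ ∘ sym)
          | distinct-irrefl a | distinct-irrefl b | irrefl G a | irrefl G b | symm G b a | ab
    = refl

  pivot-other : ∀ {w x} → w ≢ a → w ≢ b → x ≢ a → x ≢ b →
    adj (pivot G a b) w x ≡
      adj G w x xor ((adj G a w ∧ adj G b x) xor (adj G a x ∧ adj G b w))
  pivot-other {w} {x} w≢a w≢b x≢a x≢b
    rewrite distinct-≢ (w≢a ∘ sym) | distinct-≢ (w≢b ∘ sym)
          | distinct-≢ (x≢a ∘ sym) | distinct-≢ (x≢b ∘ sym)
          | distinct-≢ (adjacent⇒≢ ∘ sym)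
          | irrefl G a | symm G b a | ab
    with w ≟ x
  ... | yes refl rewrite irrefl G w with adj G a w | adj G b w
  ...   | true  | true  = refl
  ...   | true  | false = refl
  ...   | false | true  = refl
  ...   | false | false = refl
  pivot-other {w} {x} w≢a w≢b x≢a x≢b | no _ =
    -- The three added products come from the complementations at a, b and a in turn; characteristic
    -- 2 cancels `aw ax` and `bw bx`.
    solve 5 (λ wx aw bw ax bx →
      ((wx :+ (aw :* ax) :* con true)
        :+ ((bw :+ aw :* con true) :* (bx :+ ax :* con true)) :* con true)
        :+ (((aw :+ con false) :+ (bw :+ aw :* con true) :* con true)
             :* ((ax :+ con false) :+ (bx :+ ax :* con true) :* con true)) :* con true
      := wx :+ (aw :* bx :+ ax :* bw)) refl
      (adj G w x) (adj G a w) (adj G b w) (adj G a x) (adj G b x)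

  pivot-isPivot : IsPivot G a b (pivot G a b)
  pivot-isPivot = record
    { edge   = ab
    ; edge′  = pivot-edge
    ; swaps  = pivot-swaps
    ; swaps′ = pivot-swaps′
    ; other  = pivot-other
    }

-- Graph spaces and twists

GraphSpace : Graph n → (Fin n → Bool) → (Fin n → Bool) → Set
GraphSpace G X Y = ∀ v → Y v ≡ sum (λ w → adj G v w ∧ X w)

GraphSpace-resp-≗ : (G : Graph n) {X X′ Y Y′ : Fin n → Bool} →
                    X′ ≗ X → Y′ ≗ Y → GraphSpace G X Y → GraphSpace G X′ Y′
GraphSpace-resp-≗ G X′≗X Y′≗Y Y≡AX v = trans (Y′≗Y v)
  (trans (Y≡AX v) (sum-cong-≗ λ w → cong (adj G v w ∧_) (sym (X′≗X w))))

GraphSpace-xor : (G : Graph n) {X₁ X₂ Y₁ Y₂ : Fin n → Bool} →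
                 GraphSpace G X₁ Y₁ → GraphSpace G X₂ Y₂ →
                 GraphSpace G (λ w → X₁ w xor X₂ w) (λ w → Y₁ w xor Y₂ w)
GraphSpace-xor G {X₁} {X₂} p q v = trans (cong₂ _xor_ (p v) (q v))
  (trans (sym (∑-distrib-+ (λ w → adj G v w ∧ X₁ w) (λ w → adj G v w ∧ X₂ w)))
         (sum-cong-≗ λ w → sym (∧-distribˡ-xor (adj G v w) (X₁ w) (X₂ w))))

GraphSpace-∧ : (G : Graph n) {X Y : Fin n → Bool} (c : Bool) → GraphSpace G X Y →
               GraphSpace G (λ w → c ∧ X w) (λ w → c ∧ Y w)
GraphSpace-∧ G true  p = p
GraphSpace-∧ {n} G false p v =
  sym (trans (sum-cong-≗ λ w → ∧-zeroʳ (adj G v w)) (sum-replicate-zero n))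

row-GraphSpace : (G : Graph n) (u : Fin n) → GraphSpace G (δ u) (adj G u)
row-GraphSpace G u v = sym (trans
  (sum-cong-≗ λ w → ∧-comm (adj G v w) (δ u w))
  (trans (sum-δ u (adj G v)) (symm G v u)))

-- The first half of the row (e_u , A e_u), after exchanging its two halves at
-- the vertices of T. The second half is twistedRow (not ∘ T).
twistedRow : (Fin n → Bool) → Graph n → Fin n → Fin n → Bool
twistedRow T G u w = if T w then adj G u w else δ u w

-- Only the generators of the graph space of H are required to land in that of G. By linearity, and
-- since both spaces have dimension n, the twist then carries one onto the other.
TwistOf : Graph n → (Fin n → Bool) → Graph n → Set
TwistOf G T H = ∀ u → GraphSpace G (twistedRow T H u) (twistedRow (not ∘ T) H u)

TwistOf-refl : (G : Graph n) → TwistOf G (λ _ → false) G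
TwistOf-refl = row-GraphSpace

toggle : Fin n → Fin n → (Fin n → Bool) → Fin n → Bool
toggle a b T w = T w xor (δ a w xor δ b w)

module _ {G G′ : Graph n} {a b : Fin n} (isPivot : IsPivot G a b G′) where
  open IsPivot isPivot

  private
    a≢b : a ≢ b
    a≢b = adjacent⇒≢ G edge

    ba : adj G b a ≡ true
    ba = trans (symm G b a) edge

    edge′-sym : adj G′ b a ≡ true
    edge′-sym = trans (symm G′ b a) edge′

    swapsˡ : ∀ {w} → w ≢ a → w ≢ b → adj G′ w a ≡ adj G w b
    swapsˡ w≢a w≢b = trans (symm G′ _ a) (trans (swaps w≢a w≢b) (symm G b _))

    swaps′ˡ : ∀ {w} → w ≢ a → w ≢ b → adj G′ w b ≡ adj G w a
    swaps′ˡ w≢a w≢b = trans (symm G′ _ b) (trans (swaps′ w≢a w≢b) (symm G a _))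

  -- Toggling the twist at a and b absorbs the pivot: the new rows of a and b are the old rows of b
  -- and a, and every other new row is a sum of old ones. A pivot thus only changes the basis of a
  -- fixed space.
  twistedRow-pivotˡ : ∀ T → twistedRow (toggle a b T) G′ a ≗ twistedRow T G b
  twistedRow-pivotˡ T w with w ≟ a | w ≟ b
  ... | yes refl | yes refl = contradiction refl a≢b
  ... | yes refl | no _
    rewrite δ-refl a | δ-≢ (a≢b ∘ sym) | ba | irrefl G′ a with T a
  ...   | true  = refl
  ...   | false = refl
  twistedRow-pivotˡ T w | no _ | yes refl
    rewrite δ-refl b | δ-≢ a≢b | edge′ | irrefl G b with T b
  ...   | true  = refl
  ...   | false = refl
  twistedRow-pivotˡ T w | no w≢a | no w≢b
    rewrite δ-≢ (w≢a ∘ sym) | δ-≢ (w≢b ∘ sym) | swaps w≢a w≢b | xor-identityʳ (T w)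
    = refl

  twistedRow-pivotʳ : ∀ T → twistedRow (toggle a b T) G′ b ≗ twistedRow T G a
  twistedRow-pivotʳ T w with w ≟ a | w ≟ b
  ... | yes refl | yes refl = contradiction refl a≢b
  ... | yes refl | no _
    rewrite δ-refl a | δ-≢ (a≢b ∘ sym) | edge′-sym | irrefl G a with T a
  ...   | true  = refl
  ...   | false = refl
  twistedRow-pivotʳ T w | no _ | yes refl
    rewrite δ-refl b | δ-≢ a≢b | edge | irrefl G′ b with T b
  ...   | true  = refl
  ...   | false = refl
  twistedRow-pivotʳ T w | no w≢a | no w≢b
    rewrite δ-≢ (w≢a ∘ sym) | δ-≢ (w≢b ∘ sym) | swaps′ w≢a w≢b | xor-identityʳ (T w)
    = refl

  -- Gaussian elimination: as `adj G a b` is 1 and the diagonal is 0, adding these multiples of rows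
  -- a and b clears the adjacency entries of row u at both vertices. Elsewhere it produces
  -- `IsPivot.other`.
  twistedRow-pivot-other : ∀ T {u} → u ≢ a → u ≢ b → ∀ w →
    twistedRow (toggle a b T) G′ u w ≡
      twistedRow T G u w xor
        ((adj G u b ∧ twistedRow T G a w) xor (adj G u a ∧ twistedRow T G b w))
  twistedRow-pivot-other T {u} u≢a u≢b w with w ≟ a | w ≟ b
  ... | yes refl | yes refl = contradiction refl a≢b
  ... | yes refl | no _
    rewrite δ-refl a | δ-≢ (a≢b ∘ sym) | δ-≢ u≢a | ba | irrefl G a | swapsˡ u≢a u≢b
    with T a
  ...   | true  rewrite ∧-zeroʳ (adj G u b) | ∧-identityʳ (adj G u a) = sym (xor-same (adj G u a))
  ...   | false rewrite ∧-identityʳ (adj G u b) | ∧-zeroʳ (adj G u a) = sym (xor-identityʳ _)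
  twistedRow-pivot-other T {u} u≢a u≢b w | no _ | yes refl
    rewrite δ-refl b | δ-≢ a≢b | δ-≢ u≢b | edge | irrefl G b | swaps′ˡ u≢a u≢b
    with T b
  ...   | true  rewrite ∧-identityʳ (adj G u b) | ∧-zeroʳ (adj G u a) | xor-identityʳ (adj G u b)
                = sym (xor-same (adj G u b))
  ...   | false rewrite ∧-zeroʳ (adj G u b) | ∧-identityʳ (adj G u a) = refl
  twistedRow-pivot-other T {u} u≢a u≢b w | no w≢a | no w≢b
    rewrite δ-≢ (w≢a ∘ sym) | δ-≢ (w≢b ∘ sym) | xor-identityʳ (T w)
          | other u≢a u≢b w≢a w≢b | symm G u a | symm G u b
    with T w
  ...   | true  = solve 5 (λ uw ua ub aw bw →
                    uw :+ (ua :* bw :+ aw :* ub) := uw :+ (ub :* aw :+ ua :* bw)) refl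
                    (adj G u w) (adj G a u) (adj G b u) (adj G a w) (adj G b w)
  ...   | false = sym (trans
                  (cong (δ u w xor_) (cong₂ _xor_ (∧-zeroʳ (adj G b u)) (∧-zeroʳ (adj G a u))))
                  (xor-identityʳ _))

  TwistOf-pivot : ∀ {B T} → TwistOf B T G → TwistOf B (toggle a b T) G′
  TwistOf-pivot {B} {T} rows u = by-cases
    where
    -- Complementing commutes with toggling, so the lemmas on first halves, used with `not ∘ T`,
    -- also settle the second halves.
    complement : ∀ v → twistedRow (not ∘ toggle a b T) G′ v ≗
                       twistedRow (toggle a b (not ∘ T)) G′ v
    complement v w = cong (if_then adj G′ v w else δ v w) (not-distribˡ-xor (T w) _)

    by-cases : GraphSpace B (twistedRow (toggle a b T) G′ u)
                            (twistedRow (not ∘ toggle a b T) G′ u)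
    by-cases with u ≟ a | u ≟ b
    ... | yes refl | _ = GraphSpace-resp-≗ B (twistedRow-pivotˡ T)
            (λ w → trans (complement u w) (twistedRow-pivotˡ (not ∘ T) w)) (rows b)
    ... | no _ | yes refl = GraphSpace-resp-≗ B (twistedRow-pivotʳ T)
            (λ w → trans (complement u w) (twistedRow-pivotʳ (not ∘ T) w)) (rows a)
    ... | no u≢a | no u≢b = GraphSpace-resp-≗ B (twistedRow-pivot-other T u≢a u≢b)
            (λ w → trans (complement u w) (twistedRow-pivot-other (not ∘ T) u≢a u≢b w))
            (GraphSpace-xor B (rows u)
              (GraphSpace-xor B (GraphSpace-∧ B (adj G u b) (rows a))
                                (GraphSpace-∧ B (adj G u a) (rows b))))

-- Colourings

ColouredOff : Graph n → Fin n → (Fin n → Bool) → Set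
ColouredOff G v c = ∀ x y → x ≢ v → y ≢ v → adj G x y ≡ true → c x ≡ not (c y)

colour-triangle : {G : Graph n} {v : Fin n} {c : Fin n → Bool} → ColouredOff G v c →
                  ∀ {x y z} → x ≢ v → y ≢ v → z ≢ v →
                  adj G x y ≡ true → adj G y z ≡ true → ¬ adj G x z ≡ true
colour-triangle {c = c} col {x} {y} {z} x≢v y≢v z≢v xy yz xz
  with c x | c y | c z | col x y x≢v y≢v xy | col y z y≢v z≢v yz | col x z x≢v z≢v xz
... | true  | false | true  | refl | refl | ()
... | false | true  | false | refl | refl | ()

-- The symplectic pairing of (c X₁ , (1 - c) Y₁) with (X₂ , Y₂) vanishes: as far as
-- the support of X₂ can tell, a proper c keeps the former in the graph space.
colour-pairing : (G : Graph n) (c : Fin n → Bool) {X₁ Y₁ X₂ Y₂ : Fin n → Bool} →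
  GraphSpace G X₁ Y₁ → GraphSpace G X₂ Y₂ →
  (∀ w x → X₁ w ≡ true → X₂ x ≡ true → adj G w x ≡ true → c w ≡ not (c x)) →
  sum (λ w → (c w ∧ X₁ w) ∧ Y₂ w) ≡ sum (λ w → (not (c w) ∧ X₂ w) ∧ Y₁ w)
colour-pairing G c {X₁} {Y₁} {X₂} {Y₂} p₁ p₂ proper = begin
  sum (λ w → (c w ∧ X₁ w) ∧ Y₂ w)
    ≡⟨ sum-cong-≗ (λ w → trans (cong ((c w ∧ X₁ w) ∧_) (p₂ w))
                           (*-distribˡ-sum (c w ∧ X₁ w) λ x → adj G w x ∧ X₂ x)) ⟩
  sum (λ w → sum λ x → (c w ∧ X₁ w) ∧ (adj G w x ∧ X₂ x))
    ≡⟨ sum-cong-≗ (λ w → sum-cong-≗ λ x → transpose w x) ⟩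
  sum (λ w → sum λ x → (not (c x) ∧ X₂ x) ∧ (adj G x w ∧ X₁ w))
    ≡⟨ ∑-comm (λ w x → (not (c x) ∧ X₂ x) ∧ (adj G x w ∧ X₁ w)) ⟩
  sum (λ x → sum λ w → (not (c x) ∧ X₂ x) ∧ (adj G x w ∧ X₁ w))
    ≡⟨ sum-cong-≗ (λ x → trans (cong ((not (c x) ∧ X₂ x) ∧_) (p₁ x))
                           (*-distribˡ-sum (not (c x) ∧ X₂ x) λ w → adj G x w ∧ X₁ w)) ⟨
  sum (λ w → (not (c w) ∧ X₂ w) ∧ Y₁ w) ∎
  where
  open ≡-Reasoning

  transpose : ∀ w x → (c w ∧ X₁ w) ∧ (adj G w x ∧ X₂ x) ≡ (not (c x) ∧ X₂ x) ∧ (adj G x w ∧ X₁ w)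
  transpose w x rewrite symm G x w with X₁ w | X₂ x | adj G w x | proper w x
  -- When the three factors other than the colour are 1, `proper` equates the two colour factors; in
  -- all other cases both sides vanish.
  ... | true  | true  | true  | eq rewrite eq refl refl refl = refl
  ... | true  | true  | false | _ = trans (∧-zeroʳ _) (sym (∧-zeroʳ _))
  ... | true  | false | a     | _ rewrite ∧-zeroʳ a | ∧-zeroʳ (not (c x)) = ∧-zeroʳ _
  ... | false | q     | a     | _ rewrite ∧-zeroʳ (c w) | ∧-zeroʳ a = sym (∧-zeroʳ _)

-- Since v lies outside T, the first halves of the twisted rows of x and y vanish at v, so
-- `colour-pairing` applies to them. Untwisting leaves only the terms at x and y, which add up to
-- `c′ x xor not (c′ y)`. At a vertex of T the two products trade places, hence the flipped colour
-- there.
TwistOf-coloured : {G H : Graph n} {T : Fin n → Bool} {v : Fin n} {c : Fin n → Bool} →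
                   TwistOf G T H → T v ≡ false → ColouredOff G v c →
                   ColouredOff H v (λ w → c w xor T w)
TwistOf-coloured {G = G} {H} {T} {v} {c} rows Tv col x y x≢v y≢v xy =
  xor≡false _ _ vanishes
  where
  open ≡-Reasoning

  c′ X₁ Y₁ X₂ Y₂ : _ → Bool
  c′ w = c w xor T w
  X₁ = twistedRow T H x
  Y₁ = twistedRow (not ∘ T) H x
  X₂ = twistedRow T H y
  Y₂ = twistedRow (not ∘ T) H y

  support : ∀ {u w} → u ≢ v → twistedRow T H u w ≡ true → w ≢ v
  support u≢v Xw refl rewrite Tv = u≢v (δ⇒≡ _ _ Xw)

  untwist : ∀ t c dx dy ax ay →
    ((c ∧ (if t then ax else dx)) ∧ (if not t then ay else dy)) xor
      ((not c ∧ (if t then ay else dy)) ∧ (if not t then ax else dx)) ≡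
    (dx ∧ ((c xor t) ∧ ay)) xor (dy ∧ (not (c xor t) ∧ ax))
  untwist false false = solve 4 (λ dx dy ax ay → dy :* ax := dx :* con false :+ dy :* ax) refl
  untwist false true  = solve 4 (λ dx dy ax ay →
    dx :* ay :+ con false := dx :* ay :+ dy :* con false) refl
  untwist true  false = solve 4 (λ dx dy ax ay → ay :* dx := dx :* ay :+ dy :* con false) refl
  untwist true  true  = solve 4 (λ dx dy ax ay →
    ax :* dy :+ con false := dx :* con false :+ dy :* ax) refl

  vanishes : c′ x xor not (c′ y) ≡ false
  vanishes = begin
    c′ x xor not (c′ y)
      ≡⟨ cong₂ _xor_ (sym (trans (cong (c′ x ∧_) (trans (symm H y x) xy)) (∧-identityʳ _)))
                     (sym (trans (cong (not (c′ y) ∧_) xy) (∧-identityʳ _))) ⟩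
    (c′ x ∧ adj H y x) xor (not (c′ y) ∧ adj H x y)
      ≡⟨ cong₂ _xor_ (sum-δ x (λ w → c′ w ∧ adj H y w)) (sum-δ y (λ w → not (c′ w) ∧ adj H x w)) ⟨
    sum (λ w → δ x w ∧ (c′ w ∧ adj H y w)) xor sum (λ w → δ y w ∧ (not (c′ w) ∧ adj H x w))
      ≡⟨ ∑-distrib-+ (λ w → δ x w ∧ (c′ w ∧ adj H y w)) _ ⟨
    sum (λ w → (δ x w ∧ (c′ w ∧ adj H y w)) xor (δ y w ∧ (not (c′ w) ∧ adj H x w)))
      ≡⟨ sum-cong-≗ (λ w → untwist (T w) (c w) (δ x w) (δ y w) (adj H x w) (adj H y w)) ⟨
    sum (λ w → ((c w ∧ X₁ w) ∧ Y₂ w) xor ((not (c w) ∧ X₂ w) ∧ Y₁ w))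
      ≡⟨ ∑-distrib-+ (λ w → (c w ∧ X₁ w) ∧ Y₂ w) _ ⟩
    sum (λ w → (c w ∧ X₁ w) ∧ Y₂ w) xor sum (λ w → (not (c w) ∧ X₂ w) ∧ Y₁ w)
      ≡⟨ cong (_xor sum (λ w → (not (c w) ∧ X₂ w) ∧ Y₁ w)) (colour-pairing G c (rows x) (rows y)
           λ w z Xw Xz → col w z (support x≢v Xw) (support y≢v Xz)) ⟩
    sum (λ w → (not (c w) ∧ X₂ w) ∧ Y₁ w) xor sum (λ w → (not (c w) ∧ X₂ w) ∧ Y₁ w)
      ≡⟨ xor-same (sum (λ w → (not (c w) ∧ X₂ w) ∧ Y₁ w)) ⟩
    false ∎

-- Pivot-minors as induced subgraphs of pivot-equivalent graphs

-- K is an induced subgraph, avoiding v, of a graph obtained from G by pivots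
-- that avoid v.
record Hosted (G : Graph n) (v : Fin n) (K : Graph m) : Set where
  field
    host      : Graph n
    twist     : Fin n → Bool
    ι         : Fin m → Fin n
    ι-inj     : Injective _≡_ _≡_ ι
    induces   : Induces ι K host
    avoids    : ∀ u → ι u ≢ v
    untwisted : twist v ≡ false
    twistOf   : TwistOf G twist host

Hosted-[] : (G : Graph n) {v : Fin n} (f : Fin m ↣ Fin n) →
            (∀ u → Injection.to f u ≢ v) → Hosted G v (G [ f ])
Hosted-[] G f avoids = record
  { host      = G
  ; twist     = λ _ → false
  ; ι         = Injection.to f
  ; ι-inj     = Injection.injective f
  ; induces   = λ _ _ → refl
  ; avoids    = avoids
  ; untwisted = refl
  ; twistOf   = TwistOf-refl G
  }

-- A deletion only restricts `ι`, while a pivot is carried out in the host. The ends of its edge lie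
-- in the image of `ι`, so v stays untwisted.
Hosted-⟶* : {G : Graph n} {v : Fin n} {K : Graph m} {K′ : Graph k} →
            Hosted G v K → K ⟶* K′ → Hosted G v K′
Hosted-⟶* h done = h
Hosted-⟶* {v = v} {K} h (delete u s) = Hosted-⟶* {K = K - u} (record
  { host      = host
  ; twist     = twist
  ; ι         = ι ∘ punchIn u
  ; ι-inj     = λ e → punchIn-injective u _ _ (ι-inj e)
  ; induces   = λ x y → induces (punchIn u x) (punchIn u y)
  ; avoids    = avoids ∘ punchIn u
  ; untwisted = untwisted
  ; twistOf   = twistOf
  }) s
  where open Hosted h
Hosted-⟶* {G = G} {v} {K} h (pivot-at x y xy s) = Hosted-⟶* {K = pivot K x y} (record
  { host      = pivot host (ι x) (ι y)
  ; twist     = toggle (ι x) (ι y) twist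
  ; ι         = ι
  ; ι-inj     = ι-inj
  ; induces   = pivot-induces ι-inj {K} {host} induces x y
  ; avoids    = avoids
  ; untwisted = cong₂ _xor_ untwisted (cong₂ _xor_ (δ-≢ (avoids x)) (δ-≢ (avoids y)))
  ; twistOf   = TwistOf-pivot (pivot-isPivot host (trans (sym (induces x y)) xy)) {B = G} twistOf
  }) s
  where open Hosted h

Hosted-≅ : {G : Graph n} {v : Fin n} {K : Graph m} {K′ : Graph k} →
           Hosted G v K → K ≅ K′ → Hosted G v K′
Hosted-≅ {K = K} {K′} h K≅K′ = record
  { host      = host
  ; twist     = twist
  ; ι         = ι ∘ from
  ; ι-inj     = λ {x} {y} e → Injection.injective (↔⇒↣ (↔-sym bijection)) {x} {y} (ι-inj e)
  ; induces   = λ x y → trans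
      (trans (cong₂ (adj K′) (sym (strictlyInverseˡ x)) (sym (strictlyInverseˡ y)))
             (preserves (from x) (from y)))
      (induces (from x) (from y))
  ; avoids    = avoids ∘ from
  ; untwisted = untwisted
  ; twistOf   = twistOf
  }
  where
  open Hosted h
  open _≅_ K≅K′
  open Inverse bijection

-- Cycles

prev : Fin n → Fin n
prev {suc n} zero    = fromℕ n
prev {suc n} (suc i) = inject₁ i

next : Fin n → Fin n
next {suc n} i with view i
... | ‵fromℕ     = zero
... | ‵inject₁ j = suc j

prev-next : (i : Fin n) → prev (next i) ≡ i
prev-next {suc n} i with view i
... | ‵fromℕ     = refl
... | ‵inject₁ j = refl

next-prev : (i : Fin n) → next (prev i) ≡ i
next-prev {suc n} zero    rewrite view-fromℕ n = refl
next-prev {suc n} (suc i) rewrite view-inject₁ i = refl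

-- The matrix P + Pᵀ of a cyclic shift P over 𝔽₂: the n-cycle for n ≥ 3, edgeless for smaller n.
cycle : ∀ n → Graph n
cycle n = record
  { adj    = λ i j → δ (prev i) j xor δ (prev j) i
  ; symm   = λ i j → xor-comm (δ (prev i) j) (δ (prev j) i)
  ; irrefl = λ i → xor-same (δ (prev i) i)
  }

cycle-neighbours : (x : Fin n → Bool) (i : Fin n) →
                   sum (λ j → adj (cycle n) i j ∧ x j) ≡ x (prev i) xor x (next i)
cycle-neighbours x i = begin
  sum (λ j → (δ (prev i) j xor δ (prev j) i) ∧ x j)
    ≡⟨ sum-cong-≗ (λ j → trans (∧-distribʳ-xor (x j) (δ (prev i) j) (δ (prev j) i))
         (cong (λ d → (δ (prev i) j ∧ x j) xor (d ∧ x j)) (δ-prev j))) ⟩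
  sum (λ j → (δ (prev i) j ∧ x j) xor (δ (next i) j ∧ x j))
    ≡⟨ ∑-distrib-+ (λ j → δ (prev i) j ∧ x j) _ ⟩
  sum (λ j → δ (prev i) j ∧ x j) xor sum (λ j → δ (next i) j ∧ x j)
    ≡⟨ cong₂ _xor_ (sum-δ (prev i) x) (sum-δ (next i) x) ⟩
  x (prev i) xor x (next i) ∎
  where
  open ≡-Reasoning
  δ-prev : ∀ j → δ (prev j) i ≡ δ (next i) j
  δ-prev j with next i ≟ j
  ... | yes refl = trans (cong (λ h → δ h i) (prev-next i)) (δ-refl i)
  ... | no  ne   = δ-≢ λ e → ne (trans (cong next (sym e)) (next-prev j))

-- Both `prev` and `next` are permutations, so each `x j` is counted twice.
sum-neighbours : (x : Fin n → Bool) → sum (λ i → x (prev i) xor x (next i)) ≡ false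
sum-neighbours x = begin
  sum (λ i → x (prev i) xor x (next i))      ≡⟨ ∑-distrib-+ (x ∘ prev) (x ∘ next) ⟩
  sum (x ∘ prev) xor sum (x ∘ next)
    ≡⟨ cong₂ _xor_ (sym (∑-permute x rotation)) (sym (∑-permute x (↔-sym rotation))) ⟩
  sum x xor sum x                            ≡⟨ xor-same (sum x) ⟩
  false                                      ∎
  where
  open ≡-Reasoning
  rotation = mk↔ₛ′ prev next prev-next next-prev

odd : Fin n → Bool
odd zero    = false
odd (suc i) = not (odd i)

odd-inject₁ : (i : Fin n) → odd (inject₁ i) ≡ odd i
odd-inject₁ zero    = refl
odd-inject₁ (suc i) = cong not (odd-inject₁ i)

constant-along-path : ∀ {a} {A : Set a} (f : Fin (suc n) → A) →
                      (∀ i → f (suc i) ≡ f (inject₁ i)) → ∀ i → f i ≡ f zero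
constant-along-path         f step zero    = refl
constant-along-path {suc n} f step (suc i) =
  trans (step i) (constant-along-path (f ∘ inject₁) (step ∘ inject₁) i)

-- The last index n is even, so the cycle on `suc n` vertices has odd length.
module _ {n} (odd-length : odd (fromℕ n) ≡ false) where

  -- The differences x i + x (i - 1) are all equal to some D, so that
  -- x i + i D is constant along the path, and going once around gives D = 0.
  odd-cycle-kernel : (x : Fin (suc n) → Bool) → (∀ i → x (prev i) xor x (next i) ≡ false) →
                     ∀ i → x i ≡ x zero
  odd-cycle-kernel x kernel i =
    trans (sym (y≡x i)) (trans (constant-along-path y y-step i) (y≡x zero))
    where
    d y : Fin (suc n) → Bool
    d j = x j xor x (prev j)
    y j = x j xor (odd j ∧ d zero)

    two-back : ∀ j → x (prev (prev j)) ≡ x j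
    two-back j = trans (xor≡false _ _ (kernel (prev j))) (cong x (next-prev j))

    d-prev : ∀ j → d j ≡ d (prev j)
    d-prev j = trans (xor-comm (x j) (x (prev j))) (cong (x (prev j) xor_) (sym (two-back j)))

    shift : ∀ p s t {D} → s xor t ≡ D → s xor (not p ∧ D) ≡ t xor (p ∧ D)
    shift true  s t refl = solve 2 (λ s t → s :+ con false := t :+ (s :+ t)) refl s t
    shift false s t refl = solve 2 (λ s t → s :+ (s :+ t) := t :+ con false) refl s t

    y-step : ∀ j → y (suc j) ≡ y (inject₁ j)
    y-step j = trans (shift (odd j) (x (suc j)) (x (inject₁ j))
                            (constant-along-path d (d-prev ∘ suc) (suc j)))
                     (cong (λ p → x (inject₁ j) xor (p ∧ d zero)) (sym (odd-inject₁ j)))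

    -- `d zero` is the difference across the wrap-around, and y agrees with x at both ends because
    -- both indices are even.
    d≡false : d zero ≡ false
    d≡false = begin
      x zero xor x (fromℕ n)    ≡⟨ cong (x zero xor_) (sym y-last) ⟩
      x zero xor y (fromℕ n)    ≡⟨ cong (x zero xor_) (constant-along-path y y-step (fromℕ n)) ⟩
      x zero xor y zero         ≡⟨ cong (x zero xor_) (xor-identityʳ (x zero)) ⟩
      x zero xor x zero         ≡⟨ xor-same (x zero) ⟩
      false                     ∎
      where
      open ≡-Reasoning
      y-last : y (fromℕ n) ≡ x (fromℕ n)
      y-last = trans (cong (λ p → x (fromℕ n) xor (p ∧ d zero)) odd-length) (xor-identityʳ _)

    y≡x : ∀ j → y j ≡ x j
    y≡x j = trans (cong (λ D → x j xor (odd j ∧ D)) d≡false)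
                  (trans (cong (x j xor_) (∧-zeroʳ (odd j))) (xor-identityʳ (x j)))

-- Odd cycles without a vertex, and the exclusion of `C₃+P₁`

past : Fin n → Fin n → Bool
past zero    zero    = false
past zero    (suc i) = true
past (suc v) zero    = false
past (suc v) (suc i) = past v i

past-zero : (v : Fin (suc n)) → past v zero ≡ false
past-zero zero    = refl
past-zero (suc v) = refl

past-step : (v : Fin (suc n)) (i : Fin n) → inject₁ i ≢ v → past v (suc i) ≡ past v (inject₁ i)
past-step zero    zero    ne = contradiction refl ne
past-step zero    (suc i) ne = refl
past-step (suc v) zero    ne = past-zero v
past-step (suc v) (suc i) ne = past-step v i (ne ∘ cong suc)

past-last : (v : Fin (suc n)) → fromℕ n ≢ v → past v (fromℕ n) ≡ true
past-last {zero}  zero    ne = contradiction refl ne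
past-last {suc n} zero    ne = refl
past-last {suc n} (suc v) ne = past-last v (ne ∘ cong suc)

-- On an odd cycle, index parity fails only across the wrap-around. Flipping it after v (`past v i`
-- is `v < i`) moves this conflict to the edge from v to `next v`.
pathColour : Fin n → Fin n → Bool
pathColour v i = odd i xor past v i

module _ {n} (odd-length : odd (fromℕ n) ≡ false) where

  pathColour-prev : (v i : Fin (suc n)) → prev i ≢ v →
                    pathColour v i ≡ not (pathColour v (prev i))
  pathColour-prev v zero ne
    rewrite past-zero v | odd-length | past-last v ne = refl
  pathColour-prev v (suc i) ne
    rewrite past-step v i ne | odd-inject₁ i = sym (not-distribˡ-xor (odd i) _)

  cycle-coloured : (v : Fin (suc n)) → ColouredOff (cycle (suc n)) v (pathColour v)
  cycle-coloured v i j i≢v j≢v ij with prev i ≟ j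
  ... | yes refl = pathColour-prev v i j≢v
  ... | no _ with δ⇒≡ (prev j) i ij
  ...   | refl = trans (sym (not-involutive _)) (cong not (sym (pathColour-prev v j i≢v)))

  ¬Hosted-C₃+P₁ : ∀ v → ¬ Hosted (P₁ ⊕ cycle (suc n)) v C₃+P₁
  ¬Hosted-C₃+P₁ v h = excluded v avoids untwisted
    where
    open Hosted h renaming (host to H; twist to T)
    B = P₁ ⊕ cycle (suc n)

    colour : Fin (suc n) → Fin (suc (suc n)) → Bool
    -- An arbitrary colour for the isolated vertex.
    colour v zero    = false
    colour v (suc i) = pathColour v i

    coloured : ∀ v → ColouredOff B (suc v) (colour v)
    coloured v zero    zero    _   _   ()
    coloured v zero    (suc j) _   _   ()
    coloured v (suc i) zero    _   _   ()
    coloured v (suc i) (suc j) i≢v j≢v = cycle-coloured v i j (i≢v ∘ cong suc) (j≢v ∘ cong suc)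

    -- Stated for every i because, besides v, it is applied in `Y-off` to each cycle vertex outside
    -- the image of `ι`, forcing it into T.
    cycle-vertex-excluded : ∀ i → (∀ u → ι u ≢ suc i) → ¬ T (suc i) ≡ false
    cycle-vertex-excluded i av Ti =
      colour-triangle {G = H} (TwistOf-coloured {G = B} {H} twistOf Ti (coloured i))
        (av 0F) (av 1F) (av 2F)
        (sym (induces 0F 1F)) (sym (induces 1F 2F)) (sym (induces 0F 2F))

    -- Only the isolated vertex of B is left to be avoided. The row of the
    -- isolated vertex a of C₃+P₁ has Y w = 0 at every cycle vertex w ≢ a.
    isolated-vertex-excluded : (∀ u → ι u ≢ zero) → ∀ a′ → ι 3F ≢ suc a′
    -- The image of a triangle vertex supplies a cycle vertex at which X vanishes.
    isolated-vertex-excluded av a′ a≡ with ι 0F in b≡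
    ... | zero   = av 0F b≡
    ... | suc b′ = by-twist (T a) refl
      where
      open ≡-Reasoning
      a = ι 3F
      X Y : Fin (suc (suc n)) → Bool
      X = twistedRow T H a
      Y = twistedRow (not ∘ T) H a

      -- The summand at the isolated vertex of B computes to `false`.
      Y-cycle : ∀ i → Y (suc i) ≡ sum (λ j → adj (cycle (suc n)) i j ∧ X (suc j))
      Y-cycle i = twistOf a (suc i)

      -- A twisted entry of Y is one of `δ a`. An untwisted one lies in the image of `ι` and is an
      -- adjacency of the isolated vertex of `C₃+P₁`.
      Y-off : ∀ i → a ≢ suc i → Y (suc i) ≡ false
      Y-off i a≢i with any? (λ u → ι u ≟ suc i)
      ... | yes (u , refl′) with T (suc i)
      ...   | true  = δ-≢ a≢i
      ...   | false = trans (cong (adj H a) (sym refl′)) (trans (sym (induces 3F u)) (isolated u))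
        where
        isolated : ∀ u → adj C₃+P₁ 3F u ≡ false
        isolated 0F = refl
        isolated 1F = refl
        isolated 2F = refl
        isolated 3F = refl
      Y-off i a≢i | no none with T (suc i) in Ti
      ...   | true  = δ-≢ a≢i
      ...   | false = contradiction Ti (cycle-vertex-excluded i λ u e → none (u , e))

      by-twist : ∀ t → T a ≢ t
      by-twist true Ta = contradiction (trans (sym odd-sum) even-sum) λ ()
        where
        Y≗δ : ∀ i → Y (suc i) ≡ δ a′ i ∧ true
        Y≗δ i with a′ ≟ i
        ... | no ne   = Y-off i λ e → ne (suc-injective (trans (sym a≡) e))
        ... | yes refl rewrite sym a≡ | Ta = δ-refl a
        odd-sum : sum (Y ∘ suc) ≡ true
        odd-sum = trans (sum-cong-≗ Y≗δ) (sum-δ a′ (λ _ → true))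
        even-sum : sum (Y ∘ suc) ≡ false
        even-sum = trans
          (sum-cong-≗ λ i → trans (Y-cycle i) (cycle-neighbours (X ∘ suc) i))
          (sum-neighbours (X ∘ suc))
      by-twist false Ta = contradiction (trans (sym Xa) (trans X-constant Xb)) λ ()
        where
        Y-zero : ∀ i → Y (suc i) ≡ false
        Y-zero i = [ Y-on , Y-off i ]′ (toSum (a ≟ suc i))
          where
          Y-on : a ≡ suc i → Y (suc i) ≡ false
          Y-on e rewrite sym e | Ta = irrefl H a
        X-constant : X (suc a′) ≡ X (suc b′)
        X-constant = trans (constant a′) (sym (constant b′))
          where
          constant = odd-cycle-kernel odd-length (X ∘ suc) λ i →
            trans (sym (cycle-neighbours (X ∘ suc) i)) (trans (sym (Y-cycle i)) (Y-zero i))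
        Xa : X (suc a′) ≡ true
        Xa rewrite sym a≡ | Ta = δ-refl a
        Xb : X (suc b′) ≡ false
        -- Twisted, the entry is an adjacency between the isolated vertex and the triangle;
        -- untwisted, it is a delta at distinct vertices.
        Xb rewrite sym b≡ with T (ι 0F)
        ... | true  = sym (induces 3F 0F)
        ... | false = δ-≢ λ e → contradiction (ι-inj e) λ ()

    excluded : ∀ v → (∀ u → ι u ≢ v) → ¬ T v ≡ false
    excluded (suc i) av Tv = cycle-vertex-excluded i av Tv
    excluded zero    av _ with ι 3F in a≡
    ... | zero   = av 3F a≡
    ... | suc a′ = isolated-vertex-excluded av a′ a≡

-- Shortening a cycle by two

module _ (n : ℕ) where
  private
    long : Graph (suc (3 + n))
    long = P₁ ⊕ cycle (3 + n)

    1-2 : adj long 1F 2F ≡ true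
    1-2 = refl

  -- The other cycle neighbours of `1F` and `2F` are the last vertex and `3F`. Apart from the two
  -- deleted vertices, the pivot toggles at most the adjacency of these two. Once `1F` is deleted,
  -- the old `2F` has index `1F`.
  shorten-adj : Induces id (((pivot long 1F 2F) - 1F) - 1F) (P₁ ⊕ cycle (suc n))
  shorten-adj x y =
    trans (pivot-other long {1F} {2F} 1-2 (skip≢1 x) (skip≢2 x) (skip≢1 y) (skip≢2 y))
          (short x y)
    where
    skip : Fin (suc (suc n)) → Fin (suc (3 + n))
    skip = punchIn 1F ∘ punchIn 1F
    skip≢1 : ∀ x → skip x ≢ 1F
    skip≢1 x = punchInᵢ≢i 1F (punchIn 1F x)
    skip≢2 : ∀ x → skip x ≢ 2F
    skip≢2 zero    ()
    skip≢2 (suc x) ()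
    short : ∀ x y → adj long (skip x) (skip y)
              xor ((adj long 1F (skip x) ∧ adj long 2F (skip y))
                xor (adj long 1F (skip y) ∧ adj long 2F (skip x)))
            ≡ adj (P₁ ⊕ cycle (suc n)) x y
    short zero          zero          = refl
    short zero          (suc y)       = ∧-zeroʳ (adj long 1F (skip (suc y)))
    short (suc x)       zero          = trans (xor-identityʳ _) (∧-zeroʳ (adj long 1F (skip (suc x))))
    short 1F            1F            =
      trans (xor-same (adj long 1F (skip 1F) ∧ adj long 2F (skip 1F)))
            (sym (xor-same (δ (fromℕ n) zero)))
    -- `q` marks the second vertex, already adjacent to the first; `r` marks the last one, whose
    -- adjacency comes from the pivot.
    short 1F            (suc (suc y)) =
      solve 3 (λ p q r → q :+ ((p :+ con false) :* con false
                                 :+ (r :+ con false) :* con true) := r :+ q)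
        refl (δ (fromℕ n) zero) (δ (inject₁ y) zero) (δ (fromℕ n) (suc y))
    short (suc (suc x)) 1F            =
      solve 3 (λ p q r → (q :+ con false) :+ ((r :+ con false) :* con true
                                                 :+ (p :+ con false) :* con false)
                           := q :+ r)
        refl (δ (fromℕ n) zero) (δ (inject₁ x) zero) (δ (fromℕ n) (suc x))
    short (suc (suc x)) (suc (suc y)) =
      solve 3 (λ p q r → r :+ ((p :+ con false) :* con false :+ (q :+ con false) :* con false) := r)
        refl (δ (fromℕ n) (suc x)) (δ (fromℕ n) (suc y)) (adj (cycle (suc n)) (suc x) (suc y))

  lengthen-HasPivotMinor : {H : Graph m} → HasPivotMinor (P₁ ⊕ cycle (suc n)) H →
                           HasPivotMinor (P₁ ⊕ cycle (3 + n)) H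
  lengthen-HasPivotMinor {H = H} h
    with k , K , s , K≅H ← HasPivotMinor-resp-≈ {G = ((pivot long 1F 2F) - 1F) - 1F}
                             {G′ = P₁ ⊕ cycle (suc n)} {H = H} shorten-adj h
    = k , K , pivot-at 1F 2F 1-2 (delete 1F (delete 1F s)) , K≅H

-- The family of odd cycles with an isolated vertex

P₁⊕cycle3≅C₃+P₁ : P₁ ⊕ cycle 3 ≅ C₃+P₁
P₁⊕cycle3≅C₃+P₁ = record
  { bijection = mk↔ₛ′ to from (λ { 0F → refl ; 1F → refl ; 2F → refl ; 3F → refl })
                              (λ { 0F → refl ; 1F → refl ; 2F → refl ; 3F → refl })
  ; preserves = toWitness {a? = all? λ u → all? λ v →
      adj C₃+P₁ (to u) (to v) Bool.≟ adj (P₁ ⊕ cycle 3) u v} _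
  }
  where
  to from : Fin 4 → Fin 4
  to 0F = 3F
  to 1F = 0F
  to 2F = 1F
  to 3F = 2F
  from 0F = 1F
  from 1F = 2F
  from 2F = 3F
  from 3F = 0F

-- The length 2k + 3 is written so that raising k by one unfolds to adding 2.
odd-cycle-HasPivotMinor : ∀ k → HasPivotMinor (P₁ ⊕ cycle (suc (suc k · 2))) C₃+P₁
odd-cycle-HasPivotMinor zero    = _ , _ , done , P₁⊕cycle3≅C₃+P₁
odd-cycle-HasPivotMinor (suc k) = lengthen-HasPivotMinor (suc k · 2) (odd-cycle-HasPivotMinor k)

odd-fromℕ-even : ∀ k → odd (fromℕ (k · 2)) ≡ false
odd-fromℕ-even zero    = refl
odd-fromℕ-even (suc k) = trans (not-involutive _) (odd-fromℕ-even k)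

-- Pigeonhole: if f were onto, choosing preimages would inject `Fin n` into `Fin k`.
omits-vertex : k < n → (f : Fin k → Fin n) → ∃[ v ] ∀ u → f u ≢ v
omits-vertex k<n f = proj₁ missed , λ u e → proj₂ missed (u , e)
  where
  missed = ¬∀⟶∃¬ _ (λ v → ∃[ u ] f u ≡ v) (λ v → any? λ u → f u ≟ v) λ onto →
    ℕ.<⇒≱ k<n (injective⇒≤ {f = proj₁ ∘ onto} λ {x} {y} e →
      trans (sym (proj₂ (onto x))) (trans (cong f e) (proj₂ (onto y))))

proposition6p2 : InfinitelyMany (𝓕 C₃+P₁)
proposition6p2 =
  (λ k → _ , F k) ,
  (λ k → odd-cycle-HasPivotMinor k , minimal k) ,
  -- Isomorphic members have the same number 2k + 4 of vertices, which determines k.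
  λ i j i≢j F≅F → i≢j (ℕ.suc-injective (ℕ.*-cancelʳ-≡ (suc i) (suc j) 2
    (ℕ.suc-injective (ℕ.suc-injective (↔⇒≡ (_≅_.bijection F≅F))))))
  where
  F : ∀ k → Graph (suc (suc (suc k · 2)))
  F k = P₁ ⊕ cycle (suc (suc k · 2))

  minimal : ∀ k {m} → m < suc (suc (suc k · 2)) → (f : Fin m ↣ Fin (suc (suc (suc k · 2)))) →
            ¬ HasPivotMinor (F k [ f ]) C₃+P₁
  minimal k m<n f (_ , K , s , K≅) with v , avoids ← omits-vertex m<n (Injection.to f) =
    ¬Hosted-C₃+P₁ (odd-fromℕ-even (suc k)) v
      (Hosted-≅ {K = K} (Hosted-⟶* {K = F k [ f ]} (Hosted-[] (F k) f avoids) s) K≅)
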